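{- For every integer $k\ge 0$, the $X_k$ subtree of $T_B(\infty)$ with root $(1,\dots,1)$ ($k$ ones; the empty partition $()$ if $k=0$) contains exactly the partitions of length $k$; that is, its node set is the set of all partitions with exactly $k$ parts.
   Context: A partition is a finite sequence of integers $a=(a_1,\dots,a_k)$ with $a_1\ge\dots\ge a_k>0$ (the empty partition $()$ is allowed); $k$ is its length; by convention $a_j=0$ for $j>k$. $a^{\downarrow_i}$ denotes the sequence obtained from $a$ by replacing $a_i$ by $a_i+1$. $T_B(\infty)$ is the edge-labeled rooted binary tree with root $()$ in which every node $a$ has a left son $a^{\downarrow_1}$ (edge labeled $1$), and in which a nonempty node $a$ has in addition a right son exactly when, with $p\ge 1$ denoting the number of parts of $a$ equal to $a_1$, one has $a_p-a_{p+1}=1$; the right son is then $a^{\downarrow_{p+1}}$ (edge labeled $p+1$). Its nodes are the partitions generated from the root in this way. For $k\ge 1$, an $X_k$ subtree is a subtree of $T_B(\infty)$ rooted at a node $a=(i,\dots,i,a_{k+1},\dots)$ whose first $k$ parts equal $i$ and with $a_{k+1}\le i-1$, and which is: the whole subtree of $T_B(\infty)$ rooted at $a$ if $a$ has only one son; and otherwise $a$ together with its left subtree (the whole subtree rooted at its left son, and the edge to it). An $X_0$ subtree is a single node. -}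

module Defs where

open import Data.List using (List; []; _∷_; length; filter)
open import Data.List.Relation.Unary.All using (All)
open import Data.List.Relation.Unary.Linked using (Linked)
open import Data.Nat using (ℕ; zero; suc; _+_; _∸_; _≤_; _<_; _≥_; _>_; _≟_)
open import Data.Product using (∃; ∃-syntax; ∃!; _×_)
open import Level using (0ℓ)
open import Relation.Binary.Construct.Closure.ReflexiveTransitive using (Star)
open import Relation.Binary.PropositionalEquality using (_≡_; _≢_)
open import Relation.Nullary using (¬_)
open import Relation.Unary using (Pred)

IsPartition : Pred (List ℕ) 0ℓ
IsPartition a = Linked _≥_ a × All (_> 0) a

PartitionsOfLength : ℕ → Pred (List ℕ) 0ℓ
PartitionsOfLength k a = IsPartition a × length a ≡ k

-- Positions are numbered from 1; the value at index 0 is junk and never used.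
-- Past the end of the list the part is 0.
part : List ℕ → ℕ → ℕ
part a       zero          = 0
part []      (suc j)       = 0
part (x ∷ a) (suc zero)    = x
part (x ∷ a) (suc (suc j)) = part a (suc j)

-- a ↓ i adds 1 to the i-th part (again numbered from 1, with index 0 junk).
-- The list is viewed as followed by zeros, so a ↓ suc (length a) appends a
-- new part equal to 1.
infixl 6 _↓_
_↓_ : List ℕ → ℕ → List ℕ
a       ↓ zero          = a
[]      ↓ suc zero      = 1 ∷ []
[]      ↓ suc (suc i)   = 0 ∷ ([] ↓ suc i)
(x ∷ a) ↓ suc zero      = suc x ∷ a
(x ∷ a) ↓ suc (suc i)   = x ∷ (a ↓ suc i)

-- The number p of parts equal to the first part.
plateau : List ℕ → ℕ
plateau a = length (filter (_≟ part a 1) a)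

HasRightSon : Pred (List ℕ) 0ℓ
HasRightSon a = a ≢ [] × part a (plateau a) ∸ part a (plateau a + 1) ≡ 1

infix 4 _—[_]→_ _⟶_ _⟶*_

-- Edges of T_B(∞) run from father to son; the middle argument is the label.
data _—[_]→_ : List ℕ → ℕ → List ℕ → Set where
  left  : ∀ {a} → a —[ 1 ]→ a ↓ 1
  right : ∀ {a} → HasRightSon a → a —[ plateau a + 1 ]→ a ↓ (plateau a + 1)

_⟶_ : List ℕ → List ℕ → Set
a ⟶ b = ∃[ ℓ ] a —[ ℓ ]→ b

_⟶*_ : List ℕ → List ℕ → Set
_⟶*_ = Star _⟶_

Node : Pred (List ℕ) 0ℓ
Node a = [] ⟶* a

HasOnlyOneSon : Pred (List ℕ) 0ℓ
HasOnlyOneSon a = ∃! _≡_ (a ⟶_)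

-- In the second clause,
-- part a (suc k) < i is a_{k+1} ≤ i − 1 without truncated subtraction.
IsXRoot : ℕ → Pred (List ℕ) 0ℓ
IsXRoot zero        a = Node a
IsXRoot k@(suc _)   a =
  Node a × ∃[ i ] ((∀ j → 1 ≤ j → j ≤ k → part a j ≡ i) × part a (suc k) < i)

-- XSubtree k a is the node set of the X_k subtree rooted at a; it is meant for
-- a satisfying IsXRoot k.  Its edges are those of T_B(∞) between these nodes.
data XSubtree : ℕ → List ℕ → Pred (List ℕ) 0ℓ where
  single : ∀ {a} → XSubtree 0 a a
  whole  : ∀ {k a b} → HasOnlyOneSon a → a ⟶* b → XSubtree (suc k) a b
  root   : ∀ {k a} → ¬ HasOnlyOneSon a → XSubtree (suc k) a a
  left   : ∀ {k a b} → ¬ HasOnlyOneSon a → a ↓ 1 ⟶* b → XSubtree (suc k) a b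

{-# OPTIONS --safe #-}

-- Within T_B(∞), a step from a partition with first part at least 2 never
-- changes the length: a right son increments a_{p+1} = a_1 − 1 ≥ 1, which is
-- an existing part.  Conversely, a partition with first part at least 2 has a
-- father of the same length, obtained by decrementing the last part of its
-- leading run of equal parts; descending on the sum, one reaches (2,1,…,1).
module Submission where

open import Data.Empty using (⊥-elim)
open import Data.List using (List; []; _∷_; _++_; length; filter; replicate)
open import Data.List.Properties
  using (++-identityʳ; filter-++; filter-all; filter-none; length-replicate)
open import Data.List.Relation.Unary.All as All using (All; []; _∷_)
import Data.List.Relation.Unary.All.Properties as All
open import Data.List.Relation.Unary.AllPairs using (_∷_)
open import Data.List.Relation.Unary.Linked as Linked using ([]; [-]; _∷_)
open import Data.List.Relation.Unary.Linked.Properties using (Linked⇒AllPairs)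
open import Data.Nat
open import Data.Nat.Induction using (<-wellFounded)
open import Data.Nat.ListAction using (sum)
open import Data.Nat.Properties
open import Data.Product using (_×_; _,_; proj₁)
open import Data.Sum using (inj₁; inj₂)
open import Function using (flip; _on_)
open import Induction.WellFounded using (Acc; acc)
import Relation.Binary.Construct.On as On
open import Relation.Binary.Construct.Closure.ReflexiveTransitive using (ε; _◅_; _◅◅_)
open import Relation.Binary.PropositionalEquality
open import Relation.Nullary using (¬_)
open import Relation.Unary using (_≐_)
open import Defs

private
  variable
    a b c : List ℕ
    j x y : ℕ

tail-bounded : IsPartition (x ∷ c) → All (_≤ x) c
tail-bounded (linked , _) with Linked⇒AllPairs (flip ≤-trans) linked
... | bounded ∷ _ = bounded

tail-partition : IsPartition (x ∷ c) → IsPartition c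
tail-partition (linked , _ ∷ positive) = Linked.tail linked , positive

cons-partition : x > 0 → All (_≤ x) c → IsPartition c → IsPartition (x ∷ c)
cons-partition x>0 []        _                  = [-] , x>0 ∷ []
cons-partition x>0 (y≤x ∷ _) (linked , positive) = y≤x ∷ linked , x>0 ∷ positive

replicate-++-bounded : ∀ n → All (_≤ x) c → All (_≤ x) (replicate n x ++ c)
replicate-++-bounded n c≤x = All.++⁺ (All.replicate⁺ n ≤-refl) c≤x

replicate-++-partition : ∀ n → x > 0 → All (_≤ x) c → IsPartition c →
                         IsPartition (replicate n x ++ c)
replicate-++-partition zero    x>0 c≤x c-part = c-part
replicate-++-partition (suc n) x>0 c≤x c-part =
  cons-partition x>0 (replicate-++-bounded n c≤x) (replicate-++-partition n x>0 c≤x c-part)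

replicate-snoc : ∀ n (x : ℕ) c → replicate n x ++ x ∷ c ≡ x ∷ replicate n x ++ c
replicate-snoc zero    x c = refl
replicate-snoc (suc n) x c = cong (x ∷_) (replicate-snoc n x c)

all-ones : All (_> 0) c → All (_≤ 1) c → c ≡ replicate (length c) 1
all-ones []        []        = refl
all-ones (x>0 ∷ p) (x≤1 ∷ q) = cong₂ _∷_ (≤-antisym x≤1 x>0) (all-ones p q)

part-replicate : ∀ n → 1 ≤ j → j ≤ n → part (replicate n x ++ c) j ≡ x
part-replicate {suc zero}    (suc n) _ _         = refl
part-replicate {suc (suc j)} (suc n) _ (s≤s j≤n) = part-replicate n (s≤s z≤n) j≤n

part-after-replicate : ∀ n → part (replicate n x ++ c) (n + 1) ≡ part c 1
part-after-replicate zero          = refl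
-- `part` recurses only on an index with two visible successors, and `n + 1` shows its own only
-- after `n` is split; hence the separate one-element run.
part-after-replicate (suc zero)    = refl
part-after-replicate (suc (suc n)) = part-after-replicate (suc n)

↓-after-replicate : ∀ n → (replicate n x ++ c) ↓ (n + 1) ≡ replicate n x ++ (c ↓ 1)
↓-after-replicate zero              = refl
↓-after-replicate (suc zero)        = refl
↓-after-replicate {x} (suc (suc n)) = cong (x ∷_) (↓-after-replicate (suc n))

-- `plateau` counts over the whole list; strictness of `c<x` keeps any copy of `x` from hiding
-- beyond the leading run.
plateau-replicate : ∀ n → All (_< x) c → plateau (replicate (suc n) x ++ c) ≡ suc n
plateau-replicate {x} {c} n c<x = begin
  length (filter (_≟ x) (replicate (suc n) x ++ c))
    ≡⟨ cong length (filter-++ (_≟ x) (replicate (suc n) x) c) ⟩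
  length (filter (_≟ x) (replicate (suc n) x) ++ filter (_≟ x) c)
    ≡⟨ cong₂ (λ u v → length (u ++ v))
         (filter-all (_≟ x) (All.replicate⁺ (suc n) refl))
         (filter-none (_≟ x) (All.map <⇒≢ c<x)) ⟩
  length (replicate (suc n) x ++ [])
    ≡⟨ cong length (++-identityʳ (replicate (suc n) x)) ⟩
  length (replicate (suc n) x)
    ≡⟨ length-replicate (suc n) ⟩
  suc n ∎
  where open ≡-Reasoning

right-gap : ∀ n → All (_< x) c →
            HasRightSon (replicate (suc n) x ++ c) → x ∸ part c 1 ≡ 1
right-gap {x} {c} n c<x (_ , gap) rewrite plateau-replicate n c<x =
  trans (sym (cong₂ _∸_ (part-replicate {c = c} (suc n) (s≤s z≤n) ≤-refl)
                        (part-after-replicate {x} (suc n)))) gap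

right-target : ∀ n → All (_< x) c → let a = replicate (suc n) x ++ c in
               a ↓ (plateau a + 1) ≡ replicate (suc n) x ++ (c ↓ 1)
right-target n c<x rewrite plateau-replicate n c<x = ↓-after-replicate (suc n)

-- An empty `c` is allowed: its first part then counts as 0, and `c ↓ 1` appends a new part 1.
right-step : ∀ n → All (_< x) c → x ∸ part c 1 ≡ 1 →
             replicate (suc n) x ++ c ⟶ replicate (suc n) x ++ (c ↓ 1)
right-step {x} {c} n c<x gap =
  plateau u + 1 , subst (u —[ plateau u + 1 ]→_) (right-target n c<x) (right ((λ ()) , gap′))
  where
  u = replicate (suc n) x ++ c
  gap′ : part u (plateau u) ∸ part u (plateau u + 1) ≡ 1
  gap′ rewrite plateau-replicate n c<x =
    trans (cong₂ _∸_ (part-replicate {c = c} (suc n) (s≤s z≤n) ≤-refl)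
                     (part-after-replicate {x} (suc n))) gap

-- Here `a` is the tail after a first part `x`, so `count` is one less than the plateau of `x ∷ a`.
-- The run of the full list is thus visibly nonempty.
record LeadingRun (x : ℕ) (a : List ℕ) : Set where
  constructor run
  field
    count     : ℕ
    rest      : List ℕ
    split     : a ≡ replicate count x ++ rest
    smaller   : All (_< x) rest
    partition : IsPartition rest

leadingRun : IsPartition (x ∷ a) → LeadingRun x a
leadingRun {a = []} _ = run 0 [] refl [] ([] , [])
leadingRun {a = y ∷ a} part-xya@(y≤x ∷ _ , _) with m≤n⇒m<n∨m≡n y≤x
... | inj₁ y<x = run 0 (y ∷ a) refl
      (y<x ∷ All.map (λ z≤y → ≤-<-trans z≤y y<x) (tail-bounded (tail-partition part-xya)))
      (tail-partition part-xya)
... | inj₂ refl with leadingRun (tail-partition part-xya)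
...   | run n c split c<x c-part = run (suc n) c (cong (y ∷_) split) c<x c-part

-- The bound 2 separates these partitions from the all-ones ones, whose right edge appends a part.
LargePartition : ℕ → List ℕ → Set
LargePartition k a = PartitionsOfLength k a × 2 ≤ part a 1

length-replicate-++-suc : ∀ n → length (replicate n x ++ suc y ∷ c) ≡ length (replicate n x ++ y ∷ c)
length-replicate-++-suc zero    = refl
length-replicate-++-suc (suc n) = cong suc (length-replicate-++-suc n)

step-large : ∀ {k} → LargePartition k a → a ⟶ b → LargePartition k b
step-large {[]} (_ , ()) _
step-large {x ∷ a} ((part-xa , len) , x≥2) (_ , left) =
  (cons-partition (s≤s z≤n) (All.map m≤n⇒m≤1+n (tail-bounded part-xa)) (tail-partition part-xa) , len)
  , m≤n⇒m≤1+n x≥2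
step-large {x ∷ a} ((part-xa@(_ , x>0 ∷ _) , len) , x≥2) (_ , right h) with leadingRun part-xa
-- With nothing after the run, the gap is `x` itself, so a right son would force `x` to be 1.
... | run n [] refl c<x c-part with refl ← right-gap n c<x h with s≤s () ← x≥2
... | run n (y ∷ c) refl (y<x ∷ c<x) c-part
  rewrite right-target n (y<x ∷ c<x) =
  ( replicate-++-partition (suc n) x>0 (y<x ∷ All.map <⇒≤ c<x)
      (cons-partition (s≤s z≤n) (All.map m≤n⇒m≤1+n (tail-bounded c-part)) (tail-partition c-part))
  , trans (length-replicate-++-suc (suc n)) len)
  , x≥2

reachable-large : ∀ {k} → LargePartition k a → a ⟶* b → LargePartition k b
reachable-large large ε            = large
reachable-large large (step ◅ path) = reachable-large (step-large large step) path

sum-replicate-++-suc : ∀ n → sum (replicate n x ++ y ∷ c) < sum (replicate n x ++ suc y ∷ c)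
sum-replicate-++-suc         zero    = ≤-refl
sum-replicate-++-suc {x = x} (suc n) = +-monoʳ-< x (sum-replicate-++-suc n)

large-reachable : ∀ {k} → Acc (_<_ on sum) b → LargePartition (suc k) b → 2 ∷ replicate k 1 ⟶* b
large-reachable {suc (suc y) ∷ b} (acc rec) ((part-b@(_ , _ ∷ positive) , refl) , s≤s (s≤s _))
  with leadingRun part-b
large-reachable {suc (suc zero) ∷ b} (acc rec) ((part-b@(_ , _ ∷ positive) , refl) , s≤s (s≤s _))
    | run zero c refl c<x c-part =
  -- A lone leading 2 leaves only parts below 2, hence ones: this is the starting node.
  subst (λ u → 2 ∷ u ⟶* 2 ∷ c) (all-ones positive (All.map s≤s⁻¹ c<x)) ε
large-reachable {suc (suc (suc y)) ∷ b} (acc rec) ((part-b@(_ , _ ∷ positive) , refl) , s≤s (s≤s _))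
    | run zero c refl c<x c-part =
  -- The first part is at least 3 and occurs once, so undoing a left edge keeps it at least 2 and
  -- not below the next part.
  large-reachable (rec ≤-refl)
    ((cons-partition (s≤s z≤n) (All.map s≤s⁻¹ c<x) c-part , refl) , s≤s (s≤s z≤n))
  ◅◅ (_ , left) ◅ ε
large-reachable {suc (suc y) ∷ b} (acc rec) ((part-b@(_ , _ ∷ positive) , refl) , s≤s (s≤s _))
    | run (suc n) c split c<x c-part
  -- The split is regrouped so that the last copy of the first part heads the remainder; the father
  -- has `suc y` there.
  with refl ← trans split (sym (replicate-snoc n (suc (suc y)) c)) =
  large-reachable (rec (sum-replicate-++-suc (suc n)))
    ( ( replicate-++-partition (suc n) (s≤s z≤n) (n≤1+n _ ∷ All.map <⇒≤ c<x)
          (cons-partition (s≤s z≤n) (All.map s≤s⁻¹ c<x) c-part)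
      , sym (length-replicate-++-suc (suc n)))
    , s≤s (s≤s z≤n))
  -- The father's leading run stops just before the lowered part, one less than the run, so its
  -- right edge restores that part.
  ◅◅ right-step n (≤-refl ∷ c<x) (m+n∸n≡m 1 y) ◅ ε

-- This is the right edge with an empty remainder: the gap is 1 minus the default part 0.
ones-step : ∀ k → replicate (suc k) 1 ⟶ replicate (suc (suc k)) 1
ones-step k = subst₂ _⟶_ (++-identityʳ _) replicate-snoc′ (right-step k [] refl)
  where
  replicate-snoc′ : replicate (suc k) 1 ++ 1 ∷ [] ≡ replicate (suc (suc k)) 1
  replicate-snoc′ = trans (replicate-snoc (suc k) 1 []) (++-identityʳ _)

ones-node : ∀ k → Node (replicate k 1)
ones-node zero          = ε
-- The empty partition has no right son, so the first part comes from a left edge.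
ones-node (suc zero)    = (1 , left) ◅ ε
ones-node (suc (suc k)) = ones-node (suc k) ◅◅ ones-step k ◅ ε

-- The left son starts with 2, the right one with 1. Hence the subtree is cut at the right edge,
-- which leads to a longer partition.
ones-two-sons : ∀ k → ¬ HasOnlyOneSon (replicate (suc k) 1)
ones-two-sons k (_ , _ , unique)
  with () ← trans (sym (unique (1 , left))) (unique (ones-step k))

ones-partition : ∀ k → PartitionsOfLength k (replicate k 1)
ones-partition k =
  subst IsPartition (++-identityʳ _) (replicate-++-partition k (s≤s z≤n) [] ([] , []))
  , length-replicate k

ones-root : ∀ k → IsXRoot k (replicate k 1)
ones-root zero    = ε
ones-root (suc k) = ones-node (suc k) , 1 ,
  (λ j 1≤j j≤k → subst (λ u → part u j ≡ 1) (++-identityʳ _) (part-replicate (suc k) 1≤j j≤k)) ,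
  s≤s (≤-reflexive (part-past-end k))
  where
  part-past-end : ∀ k → part (replicate (suc k) 1) (suc (suc k)) ≡ 0
  part-past-end zero    = refl
  part-past-end (suc k) = part-past-end k

-- This list is the left son of the all-ones root, where the length invariant starts to hold.
two-ones-large : ∀ k → LargePartition (suc k) (2 ∷ replicate k 1)
two-ones-large k with ones-partition k
... | part-ones , len =
  (cons-partition (s≤s z≤n) (All.replicate⁺ k (s≤s z≤n)) part-ones , cong suc len) , ≤-refl

subtree-sound : ∀ k → XSubtree k (replicate k 1) b → PartitionsOfLength k b
subtree-sound zero    single          = ones-partition 0
subtree-sound (suc k) (whole only _)  = ⊥-elim (ones-two-sons k only)
subtree-sound (suc k) (root _)        = ones-partition (suc k)
subtree-sound (suc k) (left _ path)   = proj₁ (reachable-large (two-ones-large k) path)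

subtree-complete : ∀ k → PartitionsOfLength k b → XSubtree k (replicate k 1) b
subtree-complete {[]} zero _ = single
subtree-complete {zero ∷ b} (suc k) ((_ , () ∷ _) , _)
-- A first part 1 bounds all the others, so the partition is the root itself.
subtree-complete {suc zero ∷ b} (suc k) (part-b@(_ , _ ∷ positive) , refl) =
  subst (λ u → XSubtree (suc k) (replicate (suc k) 1) (1 ∷ u))
    (sym (all-ones positive (tail-bounded part-b))) (root (ones-two-sons k))
subtree-complete {suc (suc x) ∷ b} (suc k) partition =
  left (ones-two-sons k)
    (large-reachable (On.wellFounded sum <-wellFounded _) (partition , s≤s (s≤s z≤n)))

corollary1 : (k : ℕ) → IsXRoot k (replicate k 1) × (XSubtree k (replicate k 1) ≐ PartitionsOfLength k)
corollary1 k = ones-root k , subtree-sound k , subtree-complete k
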